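{- For every $n\ge 2$, it is possible to place $n-1$ queens on an $n\times n$ chessboard whose square $(i,j)$ ($1\le i,j\le n$) is labeled $|i-j|$ so that no two queens attack each other, where two queens attack each other if they lie in the same row, in the same column, or on squares with the same label.
   Context: The chessboard corresponds to the symmetric Toeplitz matrix $T_n$ with entries $t_{ij}=|i-j|$. -}

module Defs where

open import Data.Fin using (Fin; toℕ)
open import Data.Nat using (ℕ; ∣_-_∣)
open import Data.Product using (_×_; _,_; proj₁; proj₂)
open import Data.Sum using (_⊎_)
open import Relation.Binary.PropositionalEquality using (_≡_; _≢_)
open import Relation.Nullary using (¬_)

Square : ℕ → Set
Square n = Fin n × Fin n

row col : ∀ {n} → Square n → Fin n
row = proj₁
col = proj₂

-- Indices run from 0 rather than 1; ∣ i - j ∣ is unaffected by the shift.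
label : ∀ {n} → Square n → ℕ
label (i , j) = ∣ toℕ i - toℕ j ∣

Attack : ∀ {n} → Square n → Square n → Set
Attack s t = row s ≡ row t ⊎ col s ≡ col t ⊎ label s ≡ label t

-- A placement of k queens is a family of squares indexed by Fin k.  Distinct
-- queens on one square would share a row, so NonAttacking forces injectivity.
Placement : ℕ → ℕ → Set
Placement k n = Fin k → Square n

NonAttacking : ∀ {k n} → Placement k n → Set
NonAttacking Q = ∀ p q → p ≢ q → ¬ Attack (Q p) (Q q)

{-# OPTIONS --safe #-}

-- Induction on the size of the board.  The placement of n queens on the board
-- of size n + 1 keeps its last row empty.  A half-turn of this board preserves
-- labels and moves the empty row to the top.  Bordering the turned board with
-- a new last row and a new last column leaves room for one more queen in the
-- top right corner, whose label n + 1 exceeds all labels of the old board; the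
-- new last row stays empty.  The queens alternate between two adjacent
-- antidiagonals.
module Submission where

open import Data.Empty using (⊥-elim)
open import Data.Fin using (zero; suc; toℕ; fromℕ; inject₁; opposite)
open import Data.Fin.Properties
  using (toℕ<n; toℕ-fromℕ; toℕ-inject₁; opposite-prop; opposite-involutive;
         inject₁-injective; fromℕ≢inject₁)
open import Data.Nat using (ℕ; suc; _∸_; _≤_; _<_; ∣_-_∣)
open import Data.Nat.Properties
  using (∣n-n∣≡0; ∣-∣-comm; ∣m-n∣≤m⊔n; m≤n⇒∣n-m∣≡n∸m; m∸n≤m; m∸[m∸n]≡n;
         ⊔-pres-<m; ≤-<-trans; <⇒≢)
open import Data.Product using (Σ; _,_; map)
open import Data.Sum using (inj₁; inj₂)
open import Function using (_∘_)
open import Function.Definitions using (Injective)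
open import Relation.Binary.Definitions using (Symmetric)
open import Relation.Binary.PropositionalEquality
  using (_≡_; _≢_; refl; sym; trans; cong; cong₂; module ≡-Reasoning)
open import Relation.Nullary using (¬_)
open import Defs

opposite-injective : ∀ {n} → Injective _≡_ _≡_ (opposite {n})
opposite-injective {x = i} {j} eq =
  trans (sym (opposite-involutive i)) (trans (cong opposite eq) (opposite-involutive j))

label-inject₁ : ∀ {n} (s : Square n) → label (map inject₁ inject₁ s) ≡ label s
label-inject₁ (i , j) = cong₂ ∣_-_∣ (toℕ-inject₁ i) (toℕ-inject₁ j)

-- The half-turn reverses both coordinates, so their difference only changes sign. The recursion
-- peels off one row and one column at a time until a coordinate is `zero`.
label-opposite : ∀ {n} (s : Square n) → label (map opposite opposite s) ≡ label s
label-opposite {suc n} (zero , zero) = ∣n-n∣≡0 (toℕ (fromℕ n))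
label-opposite {suc n} (zero , suc j) = begin
  ∣ toℕ (fromℕ n) - toℕ (inject₁ (opposite j)) ∣
    ≡⟨ cong₂ ∣_-_∣ (toℕ-fromℕ n) (trans (toℕ-inject₁ _) (opposite-prop j)) ⟩
  ∣ n - n ∸ suc (toℕ j) ∣
    ≡⟨ m≤n⇒∣n-m∣≡n∸m (m∸n≤m n (suc (toℕ j))) ⟩
  n ∸ (n ∸ suc (toℕ j))
    ≡⟨ m∸[m∸n]≡n (toℕ<n j) ⟩
  suc (toℕ j) ∎
  where open ≡-Reasoning
label-opposite (suc i , zero) =
  trans (∣-∣-comm (toℕ (opposite (suc i))) _) (label-opposite (zero , suc i))
label-opposite (suc i , suc j) =
  trans (label-inject₁ (opposite i , opposite j)) (label-opposite (i , j))

label<n : ∀ {n} (s : Square n) → label s < n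
label<n (i , j) = ≤-<-trans (∣m-n∣≤m⊔n (toℕ i) (toℕ j)) (⊔-pres-<m (toℕ<n i) (toℕ<n j))

turn : ∀ {n} → Square n → Square (suc n)
turn = map (inject₁ ∘ opposite) (inject₁ ∘ opposite)

label-turn : ∀ {n} (s : Square n) → label (turn s) ≡ label s
label-turn s = trans (label-inject₁ (map opposite opposite s)) (label-opposite s)

Attack-sym : ∀ {n} → Symmetric (Attack {n})
Attack-sym (inj₁ r)        = inj₁ (sym r)
Attack-sym (inj₂ (inj₁ c)) = inj₂ (inj₁ (sym c))
Attack-sym (inj₂ (inj₂ l)) = inj₂ (inj₂ (sym l))

-- `turn` acts injectively on each coordinate and keeps labels, so an attack pulls back to the
-- smaller board.
Attack-turn⁻ : ∀ {n} (s t : Square n) → Attack (turn s) (turn t) → Attack s t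
Attack-turn⁻ s t (inj₁ r)        = inj₁ (opposite-injective (inject₁-injective r))
Attack-turn⁻ s t (inj₂ (inj₁ c)) = inj₂ (inj₁ (opposite-injective (inject₁-injective c)))
Attack-turn⁻ s t (inj₂ (inj₂ l)) =
  inj₂ (inj₂ (trans (sym (label-turn s)) (trans l (label-turn t))))

corner : ∀ n → Square (suc n)
corner n = zero , fromℕ n

-- The half-turn brings only the last row to the top, `turn` never reaches the new last column, and
-- old labels stay below `suc n`, the label of the corner.
corner-safe : ∀ {n} (s : Square (suc n)) → row s ≢ fromℕ n →
              ¬ Attack (corner (suc n)) (turn s)
corner-safe s r≢last (inj₁ r) =
  -- By computation `zero` is `inject₁ zero` and `opposite zero` is `fromℕ n`.
  r≢last (opposite-injective (trans (inject₁-injective (sym r)) (sym (opposite-involutive zero))))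
corner-safe s _ (inj₂ (inj₁ c)) = fromℕ≢inject₁ c
corner-safe {n} s _ (inj₂ (inj₂ l)) =
  <⇒≢ (label<n s) (trans (sym (label-turn s)) (trans (sym l) (toℕ-fromℕ (suc n))))

queens : ∀ n → Placement n (suc n)
queens (suc n) zero    = corner (suc n)
queens (suc n) (suc p) = turn (queens n p)

-- The invariant that frees the top row for the next corner queen. A corner queen sits in row `zero`
-- of a board with at least two rows, and `inject₁` misses the last row.
queens-row≢last : ∀ n p → row (queens n p) ≢ fromℕ n
queens-row≢last (suc n) zero    ()
queens-row≢last (suc n) (suc p) = fromℕ≢inject₁ ∘ sym

queens-nonAttacking : ∀ n → NonAttacking (queens n)
queens-nonAttacking (suc n) zero    zero    p≢q = ⊥-elim (p≢q refl)
queens-nonAttacking (suc n) zero    (suc q) _   =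
  corner-safe (queens n q) (queens-row≢last n q)
queens-nonAttacking (suc n) (suc p) zero    _   =
  corner-safe (queens n p) (queens-row≢last n p) ∘ Attack-sym
queens-nonAttacking (suc n) (suc p) (suc q) p≢q =
  queens-nonAttacking n p q (p≢q ∘ cong suc) ∘ Attack-turn⁻ (queens n p) (queens n q)

theorem3 : ∀ (n : ℕ) → 2 ≤ n → Σ (Placement (n ∸ 1) n) NonAttacking
theorem3 (suc n) _ = queens n , queens-nonAttacking n
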